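{- Let $d\ge 1$ and $q\ge 2$ be integers. (a) If $\gcd(d,q)=1$, then the Hamming graph $H(d,q)$ is $\mathbb{Z}_{q^d}$-distance antimagic. In particular, the complete graph $K_q$ is $\mathbb{Z}_q$-distance antimagic for every $q\ge 2$. (b) If both $d$ and $q$ are even, then $H(d,q)$ is not $\mathbb{Z}_{q^d}$-distance antimagic.
   Context: $H(d,q)$ is the graph with vertex set $\mathbb{Z}_q^d$ in which two $d$-tuples are adjacent iff they differ in exactly one coordinate (equivalently the Cartesian product of $d$ copies of $K_q$). $\mathbb{Z}_m$ is the cyclic group of integers modulo $m$. For a graph $G$ with $n$ vertices and an Abelian group $A$ of order $n$ (written additively), and a bijection $f:V(G)\to A$, the weight of $x$ is $w_f(x)=\sum_{y\in N(x)} f(y)$ computed in $A$ ($N(x)$ the open neighbourhood). $f$ is an $A$-distance antimagic labelling if all weights are pairwise distinct; $G$ is $A$-distance antimagic if it admits such a labelling. -}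

module Defs where

open import Algebra.Bundles using (AbelianGroup)
open import Data.Fin.Base using (Fin)
import Data.Fin.Properties as Fin
open import Data.Integer.Base using (ℤ; +_; 0ℤ; _+_; _-_; -_)
open import Data.Integer.Divisibility.Signed
  using (_∣_; divides; ∣m∣n⇒∣m+n; ∣m⇒∣-m)
import Data.Integer.Properties as ℤ
open import Data.Integer.Solver using (module +-*-Solver)
open import Data.List.Base
  using (List; []; _∷_; allFin; cartesianProductWith; filter; foldr; map)
open import Data.List.Membership.Propositional using (_∈_)
open import Data.List.Membership.Propositional.Properties
  using (∈-allFin; ∈-cartesianProductWith⁺)
open import Data.List.Relation.Unary.All using ([])
open import Data.List.Relation.Unary.AllPairs using ([]; _∷_)
open import Data.List.Relation.Unary.Any using (here)
open import Data.List.Relation.Unary.Unique.Propositional using (Unique)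
open import Data.List.Relation.Unary.Unique.Propositional.Properties
  using (allFin⁺; cartesianProductWith⁺)
open import Data.Nat.Base using (ℕ; zero; suc)
open import Data.Product using (∃; ∃!; _×_; _,_)
open import Data.Vec.Base using (Vec; []; _∷_; lookup)
open import Data.Vec.Properties using (∷-injective)
open import Function.Definitions using (Bijective)
open import Level using (Level; _⊔_; 0ℓ)
open import Relation.Binary.Definitions using (Decidable; Irreflexive; Symmetric)
open import Relation.Binary.PropositionalEquality
  using (_≡_; _≢_; refl; subst; ≢-sym)
open import Relation.Nullary using (¬_)
open import Relation.Nullary.Decidable using (¬?; _×-dec_; _→-dec_; map′)

private variable
  c ℓ : Level

------------------------------------------------------------------------
-- Finite simple graphs

-- Finiteness is given by a repetition-free list of all vertices.
record Graph : Set₁ where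
  field
    Vertex     : Set
    vertices   : List Vertex
    unique     : Unique vertices
    complete   : ∀ x → x ∈ vertices
    Adj        : Vertex → Vertex → Set
    adj?       : Decidable Adj
    adj-sym    : Symmetric Adj
    adj-irrefl : Irreflexive _≡_ Adj

  neighbours : Vertex → List Vertex
  neighbours x = filter (adj? x) vertices

------------------------------------------------------------------------
-- Distance antimagic labellings

module _ (G : Graph) (A : AbelianGroup c ℓ) where
  open Graph G
  open AbelianGroup A

  weight : (Vertex → Carrier) → Vertex → Carrier
  weight f x = foldr _∙_ ε (map f (neighbours x))

  -- The requirement that A has as many elements as G has vertices is
  -- part of the existence of a bijection.
  IsDistanceAntimagicLabelling : (Vertex → Carrier) → Set (c ⊔ ℓ)
  IsDistanceAntimagicLabelling f =
    Bijective _≡_ _≈_ f × (∀ x y → x ≢ y → ¬ weight f x ≈ weight f y)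

  DistanceAntimagic : Set (c ⊔ ℓ)
  DistanceAntimagic = ∃ IsDistanceAntimagicLabelling

------------------------------------------------------------------------
-- The cyclic group of integers modulo m

-- The quotient of ℤ by mℤ, as a setoid: elements are integers, and
-- equality of elements is congruence modulo m.

infix 4 _≡_[mod_]

_≡_[mod_] : ℤ → ℤ → ℕ → Set
a ≡ b [mod m ] = + m ∣ a - b

module _ {m : ℕ} where
  open +-*-Solver

  ≡mod-reflexive : ∀ {a b} → a ≡ b → a ≡ b [mod m ]
  ≡mod-reflexive {a} refl = divides 0ℤ (ℤ.+-inverseʳ a)

  -mod-cong : ∀ {a b} → a ≡ b [mod m ] → (- a) ≡ (- b) [mod m ]
  -mod-cong {a} {b} p = subst (+ m ∣_)
    (solve 2 (λ a b → :- (a :- b) := :- a :- :- b) refl a b) (∣m⇒∣-m p)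

  ≡mod-sym : ∀ {a b} → a ≡ b [mod m ] → b ≡ a [mod m ]
  ≡mod-sym {a} {b} p = subst (+ m ∣_)
    (solve 2 (λ a b → :- (a :- b) := b :- a) refl a b) (∣m⇒∣-m p)

  ≡mod-trans : ∀ {a b c} → a ≡ b [mod m ] → b ≡ c [mod m ] → a ≡ c [mod m ]
  ≡mod-trans {a} {b} {c} p q = subst (+ m ∣_)
    (solve 3 (λ a b c → (a :- b) :+ (b :- c) := a :- c) refl a b c)
    (∣m∣n⇒∣m+n p q)

  +mod-cong : ∀ {a b c d} →
              a ≡ b [mod m ] → c ≡ d [mod m ] → a + c ≡ b + d [mod m ]
  +mod-cong {a} {b} {c} {d} p q = subst (+ m ∣_)
    (solve 4 (λ a b c d → (a :- b) :+ (c :- d) := (a :+ c) :- (b :+ d))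
      refl a b c d)
    (∣m∣n⇒∣m+n p q)

ℤmod : ℕ → AbelianGroup 0ℓ 0ℓ
ℤmod m = record
  { Carrier        = ℤ
  ; _≈_            = _≡_[mod m ]
  ; _∙_            = _+_
  ; ε              = 0ℤ
  ; _⁻¹            = -_
  ; isAbelianGroup = record
    { isGroup = record
      { isMonoid = record
        { isSemigroup = record
          { isMagma = record
            { isEquivalence = record
              { refl  = λ {a} → ≡mod-reflexive {m} {a} refl
              ; sym   = λ {a} {b} → ≡mod-sym {m} {a} {b}
              ; trans = λ {a} {b} {c} → ≡mod-trans {m} {a} {b} {c}
              }
            ; ∙-cong = λ {a} {b} {c} {d} → +mod-cong {m} {a} {b} {c} {d}
            }
          ; assoc = λ a b c → ≡mod-reflexive (ℤ.+-assoc a b c)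
          }
        ; identity = (λ a → ≡mod-reflexive (ℤ.+-identityˡ a))
                   , (λ a → ≡mod-reflexive (ℤ.+-identityʳ a))
        }
      ; inverse = (λ a → ≡mod-reflexive (ℤ.+-inverseˡ a))
                , (λ a → ≡mod-reflexive (ℤ.+-inverseʳ a))
      ; ⁻¹-cong = λ {a} {b} → -mod-cong {m} {a} {b}
      }
    ; comm = λ a b → ≡mod-reflexive (ℤ.+-comm a b)
    }
  }

------------------------------------------------------------------------
-- Complete graphs

K : ℕ → Graph
K q = record
  { Vertex     = Fin q
  ; vertices   = allFin q
  ; unique     = allFin⁺ q
  ; complete   = ∈-allFin
  ; Adj        = _≢_
  ; adj?       = λ x y → ¬? (x Fin.≟ y)
  ; adj-sym    = ≢-sym
  ; adj-irrefl = λ x≡y x≢y → x≢y x≡y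
  }

------------------------------------------------------------------------
-- Hamming graphs

-- Only the underlying set of ℤ_q matters for the graph, so d-tuples of
-- residues are represented as vectors over Fin q.

DifferInExactlyOne : ∀ {d q} → Vec (Fin q) d → Vec (Fin q) d → Set
DifferInExactlyOne x y = ∃! _≡_ λ i → lookup x i ≢ lookup y i

differInExactlyOne? : ∀ {d q} → Decidable (DifferInExactlyOne {d} {q})
differInExactlyOne? x y = Fin.any? λ i → differ? i ×-dec
  map′ (λ u {j} → u j) (λ u j → u {j})
       (Fin.all? λ j → differ? j →-dec (i Fin.≟ j))
  where differ? = λ i → ¬? (lookup x i Fin.≟ lookup y i)

allTuples : ∀ d q → List (Vec (Fin q) d)
allTuples zero    q = [] ∷ []
allTuples (suc d) q = cartesianProductWith _∷_ (allFin q) (allTuples d q)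

allTuples-unique : ∀ d q → Unique (allTuples d q)
allTuples-unique zero    q = [] ∷ []
allTuples-unique (suc d) q =
  cartesianProductWith⁺ _∷_ ∷-injective (allFin⁺ q) (allTuples-unique d q)

allTuples-complete : ∀ {d q} (x : Vec (Fin q) d) → x ∈ allTuples d q
allTuples-complete []      = here refl
allTuples-complete (a ∷ x) =
  ∈-cartesianProductWith⁺ _∷_ (∈-allFin a) (allTuples-complete x)

H : ℕ → ℕ → Graph
H d q = record
  { Vertex     = Vec (Fin q) d
  ; vertices   = allTuples d q
  ; unique     = allTuples-unique d q
  ; complete   = allTuples-complete
  ; Adj        = DifferInExactlyOne
  ; adj?       = differInExactlyOne?
  ; adj-sym    = λ (i , x≢y , u) → i , ≢-sym x≢y , λ y≢x → u (≢-sym y≢x)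
  ; adj-irrefl = λ { refl (_ , x≢x , _) → x≢x refl }
  }

{-# OPTIONS --safe #-}
-- Label x by the integer val x = Σ qⁱ xᵢ.  Summing val over the
-- neighbours of x gives κ · val x + C with κ = d (q - 1) - q ≡ - d (mod q),
-- so for gcd(d, q) = 1 the weights are pairwise distinct modulo qᵈ.
--
-- Conversely, H(d,q) is d (q - 1)-regular, so the weights of any f add up to
-- d (q - 1) Σ f.  If f and its weights are both injective modulo N = qᵈ,
-- then Σ f and the sum of the weights are both 0 + 1 + ⋯ + (N - 1) =
-- N (N - 1) / 2 modulo N.  For even d and N the first fact makes the sum of
-- the weights 0 modulo N, whereas N (N - 1) / 2 is not.
module Submission where

open import Defs
open import Data.Bool.Base using (true; false; if_then_else_; not)
open import Data.Fin.Base using (Fin; zero; suc; toℕ; fromℕ<)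
import Data.Fin.Properties as Fin
open import Data.Integer.Base using (ℤ; +_; 0ℤ; 1ℤ; _+_; _-_; _*_; ∣_∣)
open import Data.Integer.Coprimality using (coprime-divisor)
open import Data.Integer.DivMod using (_/ℕ_; _%ℕ_; n%ℕd<d; a≡a%ℕn+[a/ℕn]*n)
import Data.Integer.Divisibility.Signed as ℤ
import Data.Integer.Properties as ℤ
open import Data.Integer.Solver using (module +-*-Solver)
open import Data.List.Base
  using (List; []; _∷_; _++_; allFin; cartesianProductWith; downFrom; filter;
         foldr; length; map)
open import Data.List.Membership.Propositional using (_∈_)
open import Data.List.Membership.Propositional.Properties
  using (∈-allFin; ∈-downFrom⁺; ∈-map⁻; ∈-∃++)
open import Data.List.Properties
  using (length-++; length-downFrom; length-map; length-tabulate)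
open import Data.List.Relation.Binary.Permutation.Propositional
  using (_↭_; ↭-refl; ↭-sym; ↭-trans; prep)
open import Data.List.Relation.Binary.Permutation.Propositional.Properties
  using (↭-length; ∈-resp-↭; shift)
open import Data.List.Relation.Unary.All as All using (All; []; _∷_)
open import Data.List.Relation.Unary.AllPairs as AllPairs using ([]; _∷_)
import Data.List.Relation.Unary.AllPairs.Properties as AllPairs
open import Data.List.Relation.Unary.Any using (here; there)
open import Data.List.Relation.Unary.Unique.Propositional using (Unique)
open import Data.List.Relation.Unary.Unique.Propositional.Properties
  using (allFin⁺)
open import Data.Nat.Base as ℕ
  using (ℕ; zero; suc; _≤_; _<_; _^_; NonZero)
open import Data.Nat.Coprimality using (Coprime; gcd≡1⇒coprime)
open import Data.Nat.Divisibility as ℕ using (_∣_)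
open import Data.Nat.GCD using (gcd)
open import Data.Nat.ListAction using (sum)
open import Data.Nat.ListAction.Properties using (sum-↭)
import Data.Nat.Properties as ℕ
import Data.Nat.Tactic.RingSolver as ℕ-Ring
open import Data.Product using (_×_; _,_; ∃)
open import Data.Vec.Base using (Vec; []; _∷_; lookup)
import Data.Vec.Properties as Vec
open import Function.Base using (_∘_; id)
open import Function.Bundles using (_⇔_; mk⇔)
open import Function.Definitions using (Bijective)
open import Relation.Binary.Definitions using (DecidableEquality)
open import Relation.Binary.PropositionalEquality
open import Relation.Nullary using (¬_; Dec; yes; no; does; contradiction)
open import Relation.Nullary.Decidable
  using (¬?; dec-true; dec-false; decidable-stable; does-≡)
  renaming (map to map-dec)
open import Relation.Unary using (Decidable)

open +-*-Solver

private variable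
  A B C : Set

-- Sums over lists

∑ : List A → (A → ℤ) → ℤ
∑ xs f = foldr _+_ 0ℤ (map f xs)

∑-cong : ∀ {f g : A → ℤ} xs → (∀ x → f x ≡ g x) → ∑ xs f ≡ ∑ xs g
∑-cong []       f≗g = refl
∑-cong (x ∷ xs) f≗g = cong₂ _+_ (f≗g x) (∑-cong xs f≗g)

∑-mod-cong : ∀ {m} {f g : A → ℤ} xs → (∀ x → f x ≡ g x [mod m ]) →
             ∑ xs f ≡ ∑ xs g [mod m ]
∑-mod-cong         []       f≗g = ≡mod-reflexive {a = 0ℤ} refl
∑-mod-cong {f = f} (x ∷ xs) f≗g =
  +mod-cong {a = f x} (f≗g x) (∑-mod-cong xs f≗g)

∑-+ : ∀ (f g : A → ℤ) xs → ∑ xs (λ x → f x + g x) ≡ ∑ xs f + ∑ xs g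
∑-+ f g []       = refl
∑-+ f g (x ∷ xs) = trans (cong (_+_ (f x + g x)) (∑-+ f g xs))
  (solve 4 (λ a b c d → (a :+ b) :+ (c :+ d) := (a :+ c) :+ (b :+ d)) refl
    (f x) (g x) (∑ xs f) (∑ xs g))

∑-minus : ∀ (f g : A → ℤ) xs → ∑ xs (λ x → f x - g x) ≡ ∑ xs f - ∑ xs g
∑-minus f g []       = refl
∑-minus f g (x ∷ xs) = trans (cong (_+_ (f x - g x)) (∑-minus f g xs))
  (solve 4 (λ a b c d → (a :- b) :+ (c :- d) := (a :+ c) :- (b :+ d)) refl
    (f x) (g x) (∑ xs f) (∑ xs g))

∑-*ˡ : ∀ k (f : A → ℤ) xs → ∑ xs (λ x → k * f x) ≡ k * ∑ xs f
∑-*ˡ k f []       = sym (ℤ.*-zeroʳ k)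
∑-*ˡ k f (x ∷ xs) = trans (cong (_+_ (k * f x)) (∑-*ˡ k f xs))
  (sym (ℤ.*-distribˡ-+ k (f x) (∑ xs f)))

∑-const : ∀ c (xs : List A) → ∑ xs (λ _ → c) ≡ + length xs * c
∑-const c []       = sym (ℤ.*-zeroˡ c)
∑-const c (x ∷ xs) =
  trans (cong (_+_ c) (∑-const c xs)) (sym (ℤ.suc-* (+ length xs) c))

∑-swap : ∀ (f : A → B → ℤ) xs ys →
         ∑ xs (λ x → ∑ ys (f x)) ≡ ∑ ys (λ y → ∑ xs (λ x → f x y))
∑-swap f []       ys = sym (trans (∑-const 0ℤ ys) (ℤ.*-zeroʳ (+ length ys)))
∑-swap f (x ∷ xs) ys = trans (cong (_+_ (∑ ys (f x))) (∑-swap f xs ys))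
  (sym (∑-+ (f x) (λ y → ∑ xs (λ x → f x y)) ys))

∑-++ : ∀ (f : A → ℤ) xs ys → ∑ (xs ++ ys) f ≡ ∑ xs f + ∑ ys f
∑-++ f []       ys = sym (ℤ.+-identityˡ (∑ ys f))
∑-++ f (x ∷ xs) ys = trans (cong (_+_ (f x)) (∑-++ f xs ys))
  (sym (ℤ.+-assoc (f x) (∑ xs f) (∑ ys f)))

∑-map : ∀ (f : B → ℤ) (g : A → B) xs → ∑ (map g xs) f ≡ ∑ xs (f ∘ g)
∑-map f g []       = refl
∑-map f g (x ∷ xs) = cong (_+_ (f (g x))) (∑-map f g xs)

∑-cartesianProductWith :
  ∀ (f : C → ℤ) (g : A → B → C) xs ys →
  ∑ (cartesianProductWith g xs ys) f ≡ ∑ xs (λ x → ∑ ys (λ y → f (g x y)))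
∑-cartesianProductWith f g []       ys = refl
∑-cartesianProductWith f g (x ∷ xs) ys =
  trans (∑-++ f (map (g x) ys) (cartesianProductWith g xs ys))
        (cong₂ _+_ (∑-map f (g x) ys) (∑-cartesianProductWith f g xs ys))

-- Zero terms in place of omitted ones make the sum range over the whole list, so a sum over
-- neighbours can be split along a product of lists and compared term by term.
∑-filter : ∀ {P : A → Set} (P? : Decidable P) (f : A → ℤ) xs →
           ∑ (filter P? xs) f ≡ ∑ xs (λ x → if does (P? x) then f x else 0ℤ)
∑-filter P? f []       = refl
∑-filter P? f (x ∷ xs) with does (P? x)
... | true  = cong (_+_ (f x)) (∑-filter P? f xs)
... | false = trans (∑-filter P? f xs) (sym (ℤ.+-identityˡ _))

∑-pos : ∀ (f : A → ℕ) xs → ∑ xs (+_ ∘ f) ≡ + sum (map f xs)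
∑-pos f []       = refl
∑-pos f (x ∷ xs) = trans (cong (_+_ (+ f x)) (∑-pos f xs))
                         (sym (ℤ.pos-+ (f x) (sum (map f xs))))

module _ (_≟_ : DecidableEquality A) (f : A → ℤ) (a : A) where

  private
    f-at : A → ℤ
    f-at b = if does (a ≟ b) then f b else 0ℤ

  ∑-indicator-∉ : ∀ {xs} → All (a ≢_) xs → ∑ xs f-at ≡ 0ℤ
  ∑-indicator-∉ []           = refl
  ∑-indicator-∉ {x ∷ _} (a≢x ∷ a∉) rewrite dec-false (a ≟ x) a≢x =
    trans (ℤ.+-identityˡ _) (∑-indicator-∉ a∉)

  -- Uniqueness keeps `a` from occurring a second time, so every other term vanishes.
  ∑-indicator : ∀ {xs} → Unique xs → a ∈ xs → ∑ xs f-at ≡ f a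
  ∑-indicator (a∉ ∷ _) (here refl) rewrite dec-true (a ≟ a) refl =
    trans (cong (_+_ (f a)) (∑-indicator-∉ a∉)) (ℤ.+-identityʳ (f a))
  ∑-indicator {x ∷ _} (x∉ ∷ u) (there a∈)
    rewrite dec-false (a ≟ x) (≢-sym (All.lookup x∉ a∈)) =
    trans (ℤ.+-identityˡ _) (∑-indicator u a∈)

  ∑-filter-≢ : ∀ {xs} → Unique xs → a ∈ xs →
               ∑ (filter (λ b → ¬? (a ≟ b)) xs) f ≡ ∑ xs f - f a
  ∑-filter-≢ {xs} u a∈ = begin
    ∑ (filter (λ b → ¬? (a ≟ b)) xs) f   ≡⟨ ∑-filter (λ b → ¬? (a ≟ b)) f xs ⟩
    ∑ xs (λ b → if not (does (a ≟ b)) then f b else 0ℤ)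
                                         ≡⟨ ∑-cong xs complement ⟩
    ∑ xs (λ b → f b - f-at b)            ≡⟨ ∑-minus f f-at xs ⟩
    ∑ xs f - ∑ xs f-at                   ≡⟨ cong (_-_ (∑ xs f)) (∑-indicator u a∈) ⟩
    ∑ xs f - f a                         ∎
    where
    open ≡-Reasoning
    complement : ∀ b → (if not (does (a ≟ b)) then f b else 0ℤ) ≡ f b - f-at b
    complement b with does (a ≟ b)
    ... | true  = sym (ℤ.+-inverseʳ (f b))
    ... | false = sym (ℤ.+-identityʳ (f b))

∑-allFin-const : ∀ q c → ∑ (allFin q) (λ _ → c) ≡ + q * c
∑-allFin-const q c = trans (∑-const c (allFin q))
  (cong (λ n → + n * c) (length-tabulate {n = q} id))

-- Sums of weights in Hamming graphs

∑N : ∀ {d q} → (Vec (Fin q) d → ℤ) → Vec (Fin q) d → ℤ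
∑N {d} {q} f x = ∑ (Graph.neighbours (H d q) x) f

module _ {d q : ℕ} where

  -- Equal heads are no difference, so the unique differing index lies in the tail.
  differ-tail : ∀ {a : Fin q} {x y : Vec (Fin q) d} →
                DifferInExactlyOne x y ⇔ DifferInExactlyOne (a ∷ x) (a ∷ y)
  differ-tail = mk⇔
    (λ (i , ne , u) → suc i , ne , λ { {zero}  a≢a → contradiction refl a≢a
                                     ; {suc j} ne′ → cong suc (u ne′) })
    (λ { (zero  , ne , u) → contradiction refl ne
       ; (suc i , ne , u) → i , ne , λ ne′ → Fin.suc-injective (u ne′) })

  -- Unequal heads already use up the single allowed difference.
  differ-head : ∀ {a b : Fin q} {x y : Vec (Fin q) d} → a ≢ b →
                x ≡ y ⇔ DifferInExactlyOne (a ∷ x) (b ∷ y)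
  differ-head {a} {b} {x} {y} a≢b = mk⇔
    (λ { refl → zero , a≢b , λ { {zero}  _  → refl
                               ; {suc j} ne → contradiction refl ne } })
    (λ { (suc i , ne , u) → contradiction (u {zero} a≢b) λ ()
       ; (zero  , ne , u) → pointwise λ i →
           -- Uniqueness only refutes a difference in the tail; decidable equality on `Fin q` turns
           -- this into equality.
           decidable-stable (lookup x i Fin.≟ lookup y i)
             λ ne → contradiction (u {suc i} ne) λ () })
    where
    pointwise : (∀ i → lookup x i ≡ lookup y i) → x ≡ y
    pointwise x≗y = trans (sym (Vec.tabulate∘lookup x))
      (trans (Vec.tabulate-cong x≗y) (Vec.tabulate∘lookup y))

  -- The Cartesian product structure of the graph: a neighbour of `a ∷ x` either keeps the head and
  -- moves to a neighbour of `x`, or keeps the tail and changes the head. All inductions on `d` for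
  -- weights rest on this.
  ∑N-∷ : ∀ (f : Vec (Fin q) (suc d) → ℤ) a x →
         ∑N f (a ∷ x) ≡
         ∑N (λ y → f (a ∷ y)) x + (∑ (allFin q) (λ b → f (b ∷ x)) - f (a ∷ x))
  ∑N-∷ f a x = begin
    ∑N f (a ∷ x)
      ≡⟨ ∑-filter adj?′ f (allTuples (suc d) q) ⟩
    ∑ (allTuples (suc d) q) (λ z → if does (adj?′ z) then f z else 0ℤ)
      ≡⟨ ∑-cartesianProductWith _ _∷_ (allFin q) (allTuples d q) ⟩
    ∑ (allFin q) slice
      ≡⟨ ∑-cong (allFin q) (λ b → slice-≡ b (a Fin.≟ b)) ⟩
    ∑ (allFin q) (λ b → f (b ∷ x) + (if does (a Fin.≟ b) then excess b else 0ℤ))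
      ≡⟨ ∑-+ (λ b → f (b ∷ x)) _ (allFin q) ⟩
    F + ∑ (allFin q) (λ b → if does (a Fin.≟ b) then excess b else 0ℤ)
      ≡⟨ cong (_+_ F) (∑-indicator Fin._≟_ excess a (allFin⁺ q) (∈-allFin a)) ⟩
    F + (∑N (λ y → f (a ∷ y)) x - f (a ∷ x))
      ≡⟨ solve 3 (λ F w v → F :+ (w :- v) := w :+ (F :- v)) refl
           F (∑N (λ y → f (a ∷ y)) x) (f (a ∷ x)) ⟩
    ∑N (λ y → f (a ∷ y)) x + (F - f (a ∷ x)) ∎
    where
    open ≡-Reasoning
    F : ℤ
    F = ∑ (allFin q) (λ b → f (b ∷ x))
    adj?′ : Decidable (DifferInExactlyOne (a ∷ x))
    adj?′ = differInExactlyOne? (a ∷ x)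
    -- `slice b` collects the neighbours with head `b`. For `b` other than `a` it is just
    -- `f (b ∷ x)`; `excess` is the correction needed at `b = a`, so that an indicator sum handles
    -- both cases at once.
    slice excess : Fin q → ℤ
    slice b =
      ∑ (allTuples d q) (λ y → if does (adj?′ (b ∷ y)) then f (b ∷ y) else 0ℤ)
    excess b = ∑N (λ y → f (b ∷ y)) x - f (b ∷ x)

    -- The decision is an argument, so that matching on it reduces the indicator.
    slice-≡ : ∀ b (a≟b : Dec (a ≡ b)) →
              slice b ≡ f (b ∷ x) + (if does a≟b then excess b else 0ℤ)
    slice-≡ b (yes refl) = begin
      slice a
        ≡⟨ ∑-cong (allTuples d q) (λ y →
             cong (λ t → if t then f (a ∷ y) else 0ℤ)
               (does-≡ (adj?′ (a ∷ y))
                 (map-dec differ-tail (differInExactlyOne? x y)))) ⟩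
      ∑ (allTuples d q)
        (λ y → if does (differInExactlyOne? x y) then f (a ∷ y) else 0ℤ)
        ≡⟨ ∑-filter (differInExactlyOne? x) _ (allTuples d q) ⟨
      ∑N (λ y → f (a ∷ y)) x
        ≡⟨ solve 2 (λ w v → w := v :+ (w :- v)) refl
             (∑N (λ y → f (a ∷ y)) x) (f (a ∷ x)) ⟩
      f (a ∷ x) + excess a ∎
    slice-≡ b (no a≢b) = begin
      slice b
        ≡⟨ ∑-cong (allTuples d q) (λ y →
             cong (λ t → if t then f (b ∷ y) else 0ℤ)
               (does-≡ (adj?′ (b ∷ y))
                 (map-dec (differ-head a≢b) (x ≟ⱽ y)))) ⟩
      ∑ (allTuples d q) (λ y → if does (x ≟ⱽ y) then f (b ∷ y) else 0ℤ)
        ≡⟨ ∑-indicator _≟ⱽ_ (λ y → f (b ∷ y)) x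
             (allTuples-unique d q) (allTuples-complete x) ⟩
      f (b ∷ x)
        ≡⟨ ℤ.+-identityʳ (f (b ∷ x)) ⟨
      f (b ∷ x) + 0ℤ ∎
      where
      _≟ⱽ_ : DecidableEquality (Vec (Fin q) d)
      _≟ⱽ_ = Vec.≡-dec Fin._≟_

-- By regularity each value of `f` is counted once per neighbour, that is `d (q - 1)` times.
-- Induction on `d` replaces the double count of edges.
∑-∑N : ∀ d q (f : Vec (Fin q) d → ℤ) →
       ∑ (allTuples d q) (∑N f) ≡ + d * (+ q - 1ℤ) * ∑ (allTuples d q) f
∑-∑N zero    q f = sym (trans
  (cong (_* ∑ (allTuples 0 q) f) (ℤ.*-zeroˡ (+ q - 1ℤ)))
  (ℤ.*-zeroˡ (∑ (allTuples 0 q) f)))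
∑-∑N (suc d) q f = begin
  ∑ (allTuples (suc d) q) (∑N f)
    ≡⟨ ∑-cartesianProductWith (∑N f) _∷_ (allFin q) ts ⟩
  ∑ (allFin q) (λ a → ∑ ts (λ x → ∑N f (a ∷ x)))
    ≡⟨ ∑-cong (allFin q) column ⟩
  ∑ (allFin q) (λ a → k * S a + (T - S a))
    ≡⟨ ∑-+ (λ a → k * S a) (λ a → T - S a) (allFin q) ⟩
  ∑ (allFin q) (λ a → k * S a) + ∑ (allFin q) (λ a → T - S a)
    ≡⟨ cong₂ _+_ (∑-*ˡ k S (allFin q)) (∑-minus (λ _ → T) S (allFin q)) ⟩
  k * T + (∑ (allFin q) (λ _ → T) - T)
    ≡⟨ cong (λ t → k * T + (t - T)) (∑-allFin-const q T) ⟩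
  k * T + (+ q * T - T)
    ≡⟨ solve 3 (λ d q T → d :* (q :- con 1ℤ) :* T :+ (q :* T :- T)
                       := (con 1ℤ :+ d) :* (q :- con 1ℤ) :* T) refl
         (+ d) (+ q) T ⟩
  + suc d * (+ q - 1ℤ) * T
    ≡⟨ cong (+ suc d * (+ q - 1ℤ) *_)
         (∑-cartesianProductWith f _∷_ (allFin q) ts) ⟨
  + suc d * (+ q - 1ℤ) * ∑ (allTuples (suc d) q) f ∎
  where
  open ≡-Reasoning
  ts = allTuples d q
  k T : ℤ
  S : Fin q → ℤ
  k   = + d * (+ q - 1ℤ)
  S a = ∑ ts (λ x → f (a ∷ x))
  T   = ∑ (allFin q) S

  -- For a fixed head `a`, moves in the tail contribute `k * S a`, and changes of the head reach
  -- every column but the one of `a`, contributing `T - S a`.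
  column : ∀ a → ∑ ts (λ x → ∑N f (a ∷ x)) ≡ k * S a + (T - S a)
  column a = begin
    ∑ ts (λ x → ∑N f (a ∷ x))
      ≡⟨ ∑-cong ts (∑N-∷ f a) ⟩
    ∑ ts (λ x → ∑N (λ y → f (a ∷ y)) x +
                (∑ (allFin q) (λ b → f (b ∷ x)) - f (a ∷ x)))
      ≡⟨ ∑-+ (∑N (λ y → f (a ∷ y))) _ ts ⟩
    ∑ ts (∑N (λ y → f (a ∷ y))) +
    ∑ ts (λ x → ∑ (allFin q) (λ b → f (b ∷ x)) - f (a ∷ x))
      ≡⟨ cong₂ _+_ (∑-∑N d q (λ y → f (a ∷ y)))
           (trans (∑-minus _ _ ts)
             (cong (_- S a) (∑-swap (λ x b → f (b ∷ x)) ts (allFin q)))) ⟩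
    k * S a + (T - S a) ∎

-- Congruences

residue-≡ : ∀ z m .{{_ : NonZero m}} → z ≡ + (z %ℕ m) [mod m ]
residue-≡ z m = ℤ.divides (z /ℕ m) (trans
  (cong (λ t → t - + (z %ℕ m)) (a≡a%ℕn+[a/ℕn]*n z m))
  (solve 2 (λ r t → r :+ t :- r := t) refl (+ (z %ℕ m)) (z /ℕ m * + m)))

-- Both numbers lie below `q`, so their difference has absolute value below `q` and is zero once `q`
-- divides it.
toℕ-injective-mod : ∀ {q} (a b : Fin q) → + toℕ a ≡ + toℕ b [mod q ] → a ≡ b
toℕ-injective-mod {q} a b p =
  Fin.toℕ-injective (ℤ.+-injective (ℤ.i-j≡0⇒i≡j (+ toℕ a) (+ toℕ b)
    (ℤ.∣i∣≡0⇒i≡0 (small (ℤ.∣⇒∣ᵤ p) abs<q))))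
  where
  small : ∀ {n} → q ∣ n → n < q → n ≡ 0
  small {zero}  q∣n n<q = refl
  small {suc n} q∣n n<q = contradiction (ℕ.∣⇒≤ q∣n) (ℕ.<⇒≱ n<q)

  abs<q : ∣ + toℕ a - + toℕ b ∣ < q
  abs<q = ℕ.≤-<-trans
    (subst (λ i → ∣ i ∣ ≤ toℕ a ℕ.⊔ toℕ b) (sym (ℤ.m-n≡m⊖n (toℕ a) (toℕ b)))
      (ℤ.∣m⊝n∣≤m⊔n (toℕ a) (toℕ b)))
    (ℕ.⊔-lub (Fin.toℕ<n a) (Fin.toℕ<n b))

-- Factors of `q` are peeled off one at a time: `q` divides `k * z`, hence `z` by coprimality, and
-- one `q` cancels on both sides. Thus coprimality to `q` itself suffices.
coprime-power-divisor : ∀ q k → Coprime q ∣ k ∣ → .{{NonZero q}} →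
                        ∀ n z → + (q ^ n) ℤ.∣ k * z → + (q ^ n) ℤ.∣ z
coprime-power-divisor q k c zero    z _ = ℤ.divides z (sym (ℤ.*-identityʳ z))
coprime-power-divisor q k c (suc n) z p
  with ℤ.divides z′ refl ← ℤ.∣ᵤ⇒∣ {+ q} {z} (coprime-divisor (+ q) k z c
         (ℤ.∣⇒∣ᵤ (ℤ.∣-trans (ℤ.∣ᵤ⇒∣ {+ q} (ℕ.m∣m*n (q ^ n))) p))) =
  subst₂ ℤ._∣_ (sym (ℤ.pos-* q (q ^ n))) (ℤ.*-comm (+ q) z′)
    (ℤ.*-monoʳ-∣ (+ q) (coprime-power-divisor q k c n z′
      (ℤ.*-cancelˡ-∣ (+ q)
        (subst₂ ℤ._∣_ (ℤ.pos-* q (q ^ n))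
          (solve 3 (λ k z q → k :* (z :* q) := q :* (k :* z)) refl k z′ (+ q))
          p))))

-- The positional labelling

val : ∀ {d q} → Vec (Fin q) d → ℤ
val         []      = 0ℤ
val {q = q} (a ∷ x) = + toℕ a + + q * val x

module _ {q : ℕ} .{{_ : NonZero q}} where

  -- The head is the least significant digit, so reduction modulo `q` determines it. With equal
  -- heads the difference is `q` times that of the tails, and `q` cancels from the modulus.
  val-injective : ∀ {d} (x y : Vec (Fin q) d) →
                  val x ≡ val y [mod q ^ d ] → x ≡ y
  val-injective         []      []      _ = refl
  val-injective {suc d} (a ∷ x) (b ∷ y) p = cong₂ _∷_ a≡b
    (val-injective x y (ℤ.*-cancelˡ-∣ (+ q)
      (subst₂ ℤ._∣_ (ℤ.pos-* q (q ^ d)) tails p)))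
    where
    digits : val (a ∷ x) - val (b ∷ y) ≡
             (+ toℕ a - + toℕ b) + + q * (val x - val y)
    digits = solve 5 (λ a b q v w → (a :+ q :* v) :- (b :+ q :* w)
                                 := (a :- b) :+ q :* (v :- w)) refl
      (+ toℕ a) (+ toℕ b) (+ q) (val x) (val y)

    a≡b : a ≡ b
    a≡b = toℕ-injective-mod a b (ℤ.∣m+n∣n⇒∣m
      (subst (+ q ℤ.∣_) digits
        (ℤ.∣-trans (ℤ.∣ᵤ⇒∣ (ℕ.m∣m*n (q ^ d))) p))
      (ℤ.∣m⇒∣m*n (val x - val y) ℤ.∣-refl))

    tails : val (a ∷ x) - val (b ∷ y) ≡ + q * (val x - val y)
    tails = trans digits (trans
      (cong (λ t → t + + q * (val x - val y))
        (ℤ.i≡j⇒i-j≡0 (cong (+_ ∘ toℕ) a≡b)))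
      (ℤ.+-identityˡ _))

  -- Division by `q`: the remainder is the head digit, and the tail comes from the quotient by
  -- induction.
  val-surjective : ∀ d z → ∃ λ (x : Vec (Fin q) d) → val x ≡ z [mod q ^ d ]
  val-surjective zero    z = [] , ℤ.divides (0ℤ - z) (sym (ℤ.*-identityʳ _))
  val-surjective (suc d) z with val-surjective d (z /ℕ q)
  ... | x , p = fromℕ< (n%ℕd<d z q) ∷ x ,
    subst₂ ℤ._∣_ (sym (ℤ.pos-* q (q ^ d))) (sym expand) (ℤ.*-monoʳ-∣ (+ q) p)
    where
    open ≡-Reasoning
    r t : ℤ
    r = + (z %ℕ q)
    t = z /ℕ q
    expand : + toℕ (fromℕ< (n%ℕd<d z q)) + + q * val x - z ≡ + q * (val x - t)
    expand = begin
      + toℕ (fromℕ< (n%ℕd<d z q)) + + q * val x - z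
        ≡⟨ cong₂ (λ a b → a + + q * val x - b)
             (cong +_ (Fin.toℕ-fromℕ< (n%ℕd<d z q))) (a≡a%ℕn+[a/ℕn]*n z q) ⟩
      r + + q * val x - (r + t * + q)
        ≡⟨ solve 4 (λ r q v t → r :+ q :* v :- (r :+ t :* q) := q :* (v :- t))
             refl r (+ q) (val x) t ⟩
      + q * (val x - t) ∎

  val-bijective : ∀ d → Bijective _≡_ _≡_[mod q ^ d ] (val {d} {q})
  val-bijective d =
    (λ {x} {y} → val-injective x y) ,
    (λ z → let x , p = val-surjective d z in
           x , λ { refl → p })

-- For `d` at least 1, the eigenvalue of the adjacency operator of `H d q` on functions of one
-- coordinate with sum zero; over the rationals `val` is a constant plus a sum of such functions.
κ : ℕ → ℕ → ℤ
κ d q = + d * (+ q - 1ℤ) - + q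

-- In closed form, `0 + 1 + ⋯ + (q - 1)` times `1 + q + ⋯ + q ^ (d - 1)`.
offset : ℕ → ℕ → ℤ
offset zero    q = 0ℤ
offset (suc d) q = + q * offset d q + ∑ (allFin q) (+_ ∘ toℕ)

-- Affine functions of `val` are the class closed under fixing the head: on the slice with head `a`,
-- the constant `c` becomes `c + k * α` and the slope `k` becomes `k * q`. This makes the induction
-- on `d` go through.
∑N-affine : ∀ {d q} (f : Vec (Fin q) d → ℤ) c k →
            (∀ y → f y ≡ c + k * val y) → ∀ x →
            ∑N f x ≡ + d * (+ q - 1ℤ) * c + k * (κ d q * val x + offset d q)
∑N-affine {zero} {q} f c k f≗ [] =
  solve 3 (λ q c k → con 0ℤ := con 0ℤ :* (q :- con 1ℤ) :* c :+
             k :* ((con 0ℤ :* (q :- con 1ℤ) :- q) :* con 0ℤ :+ con 0ℤ))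
    refl (+ q) c k
∑N-affine {suc d} {q} f c k f≗ (a ∷ x) = begin
  ∑N f (a ∷ x)
    ≡⟨ ∑N-∷ f a x ⟩
  ∑N (λ y → f (a ∷ y)) x + (∑ (allFin q) (λ b → f (b ∷ x)) - f (a ∷ x))
    ≡⟨ cong₂ _+_
         (∑N-affine (λ y → f (a ∷ y)) (c + k * α) (k * + q) slice x)
         (cong₂ _-_ line (f≗ (a ∷ x))) ⟩
  (+ d * (+ q - 1ℤ) * (c + k * α) + (k * + q) * (κ d q * v + offset d q)) +
  (+ q * (c + k * (+ q * v)) + k * β - (c + k * (α + + q * v)))
    ≡⟨ solve 8 (λ d q c k α v s β →
         (d :* (q :- con 1ℤ) :* (c :+ k :* α) :+
          (k :* q) :* ((d :* (q :- con 1ℤ) :- q) :* v :+ s)) :+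
         (q :* (c :+ k :* (q :* v)) :+ k :* β :- (c :+ k :* (α :+ q :* v)))
         := (con 1ℤ :+ d) :* (q :- con 1ℤ) :* c :+
            k :* (((con 1ℤ :+ d) :* (q :- con 1ℤ) :- q) :* (α :+ q :* v) :+
                  (q :* s :+ β)))
         refl (+ d) (+ q) c k α v (offset d q) β ⟩
  + suc d * (+ q - 1ℤ) * c +
  k * (κ (suc d) q * val (a ∷ x) + offset (suc d) q) ∎
  where
  open ≡-Reasoning
  α β v : ℤ
  α = + toℕ a
  β = ∑ (allFin q) (+_ ∘ toℕ)
  v = val x

  slice : ∀ y → f (a ∷ y) ≡ (c + k * α) + k * + q * val y
  slice y = trans (f≗ (a ∷ y))
    (solve 5 (λ c k α q w → c :+ k :* (α :+ q :* w)
                         := (c :+ k :* α) :+ k :* q :* w) refl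
      c k α (+ q) (val y))

  line : ∑ (allFin q) (λ b → f (b ∷ x)) ≡ + q * (c + k * (+ q * v)) + k * β
  line = begin
    ∑ (allFin q) (λ b → f (b ∷ x))
      ≡⟨ ∑-cong (allFin q) (λ b → trans (f≗ (b ∷ x))
           (solve 4 (λ c k b w → c :+ k :* (b :+ w)
                              := (c :+ k :* w) :+ k :* b) refl
             c k (+ toℕ b) (+ q * v))) ⟩
    ∑ (allFin q) (λ b → (c + k * (+ q * v)) + k * + toℕ b)
      ≡⟨ ∑-+ (λ _ → c + k * (+ q * v)) (λ b → k * + toℕ b) (allFin q) ⟩
    ∑ (allFin q) (λ _ → c + k * (+ q * v)) + ∑ (allFin q) (λ b → k * + toℕ b)
      ≡⟨ cong₂ _+_ (∑-allFin-const q _) (∑-*ˡ k (+_ ∘ toℕ) (allFin q)) ⟩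
    + q * (c + k * (+ q * v)) + k * β ∎

-- Since `q (d - 1) - κ d q = d`, a common divisor of `q` and `κ d q` divides `d`.
coprime-κ : ∀ d q → Coprime d q → Coprime q ∣ κ d q ∣
coprime-κ d q c {e} (e∣q , e∣κ) = c (e∣d , e∣q)
  where
  e∣ᶻq : + e ℤ.∣ + q
  e∣ᶻq = ℤ.∣ᵤ⇒∣ e∣q
  e∣d : e ∣ d
  e∣d = ℤ.∣⇒∣ᵤ (subst (+ e ℤ.∣_)
    (solve 2 (λ d q → q :* (d :- con 1ℤ) :- (d :* (q :- con 1ℤ) :- q) := d)
      refl (+ d) (+ q))
    (ℤ.∣m∣n⇒∣m-n (ℤ.∣m⇒∣m*n (+ d - 1ℤ) e∣ᶻq) (ℤ.∣ᵤ⇒∣ {i = κ d q} e∣κ)))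

-- Labellings for coprime parameters and for complete graphs

H-antimagic : ∀ d q .{{_ : NonZero q}} → Coprime d q →
              DistanceAntimagic (H d q) (ℤmod (q ^ d))
H-antimagic d q c = val , val-bijective d , λ x y x≢y w → x≢y
  (val-injective x y
    (coprime-power-divisor q (κ d q) (coprime-κ d q c) d (val x - val y)
      (subst (+ (q ^ d) ℤ.∣_) (difference x y) w)))
  where
  ∑N-val : ∀ x → ∑N val x ≡
           + d * (+ q - 1ℤ) * 0ℤ + 1ℤ * (κ d q * val x + offset d q)
  ∑N-val = ∑N-affine val 0ℤ 1ℤ λ y →
    sym (trans (ℤ.+-identityˡ _) (ℤ.*-identityˡ (val y)))

  difference : ∀ x y → ∑N val x - ∑N val y ≡ κ d q * (val x - val y)
  difference x y = trans (cong₂ _-_ (∑N-val x) (∑N-val y))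
    (solve 5 (λ z k v w s →
        (z :+ con 1ℤ :* (k :* v :+ s)) :- (z :+ con 1ℤ :* (k :* w :+ s))
        := k :* (v :- w)) refl
      (+ d * (+ q - 1ℤ) * 0ℤ) (κ d q) (val x) (val y) (offset d q))

-- The weight of `a` is the sum of all labels minus its own label, so two weights differ exactly as
-- the labels do, with opposite sign. The argument is direct because vertices of `K q` are elements
-- of `Fin q` and not vectors of length one.
K-antimagic : ∀ q .{{_ : NonZero q}} → DistanceAntimagic (K q) (ℤmod q)
K-antimagic q = f ,
  ((λ {a} {b} → toℕ-injective-mod a b) ,
   (λ z → fromℕ< (n%ℕd<d z q) , λ { refl → surjective z })) ,
  λ a b a≢b w → a≢b (sym (toℕ-injective-mod b a
    (subst (+ q ℤ.∣_) (difference a b) w)))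
  where
  f : Fin q → ℤ
  f = +_ ∘ toℕ

  surjective : ∀ z → f (fromℕ< (n%ℕd<d z q)) ≡ z [mod q ]
  surjective z = subst (λ n → + n ≡ z [mod q ])
    (sym (Fin.toℕ-fromℕ< (n%ℕd<d z q))) (≡mod-sym {a = z} (residue-≡ z q))

  ∑N-≡ : ∀ a → ∑ (Graph.neighbours (K q) a) f ≡ ∑ (allFin q) f - f a
  ∑N-≡ a = ∑-filter-≢ Fin._≟_ f a (allFin⁺ q) (∈-allFin a)

  difference : ∀ a b → ∑ (Graph.neighbours (K q) a) f -
                       ∑ (Graph.neighbours (K q) b) f ≡ f b - f a
  difference a b = trans (cong₂ _-_ (∑N-≡ a) (∑N-≡ b))
    (solve 3 (λ s a b → (s :- a) :- (s :- b) := b :- a) refl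
      (∑ (allFin q) f) (f a) (f b))

-- Sums of complete residue systems

-- A pigeonhole principle: the head of `xs` is removed from `ys` where it occurs, and uniqueness
-- keeps the rest of `xs` inside what remains.
unique-⊆⇒↭ : ∀ {xs ys : List A} → Unique xs → (∀ {x} → x ∈ xs → x ∈ ys) →
             length ys ≤ length xs → xs ↭ ys
unique-⊆⇒↭ {xs = []}     {[]}    _        _  _ = ↭-refl
unique-⊆⇒↭ {xs = x ∷ xs} {ys}    (x∉ ∷ u) xs⊆ys len
  with us , vs , refl ← ∈-∃++ (xs⊆ys (here refl)) =
  ↭-trans (prep x (unique-⊆⇒↭ u rest
    (ℕ.≤-pred (subst (_≤ suc (length xs)) (↭-length σ) len)))) (↭-sym σ)
  where
  σ : us ++ x ∷ vs ↭ x ∷ us ++ vs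
  σ = shift x us vs

  rest : ∀ {z} → z ∈ xs → z ∈ us ++ vs
  rest z∈ with ∈-resp-↭ σ (xs⊆ys (there z∈))
  ... | here refl = contradiction refl (All.lookup x∉ z∈)
  ... | there z∈′ = z∈′

-- The remainders are `m` distinct numbers below `m`, hence a permutation of `downFrom m`. This is
-- applied to a labelling and to its weights alike.
∑-residues : ∀ {m} .{{_ : NonZero m}} {xs : List A} (f : A → ℤ) →
             Unique xs → length xs ≡ m →
             (∀ x y → x ≢ y → ¬ f x ≡ f y [mod m ]) →
             ∑ xs f ≡ + sum (downFrom m) [mod m ]
∑-residues {A = A} {m = m} {xs} f u len distinct =
  ≡mod-trans {a = ∑ xs f} (∑-mod-cong xs (λ x → residue-≡ (f x) m))
    (≡mod-reflexive (trans (∑-pos r xs) (cong +_ (sum-↭ perm))))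
  where
  r : A → ℕ
  r x = f x %ℕ m

  r-distinct : ∀ {x y} → x ≢ y → r x ≢ r y
  r-distinct {x} {y} x≢y eq = distinct x y x≢y
    (≡mod-trans {a = f x} {+ r x} {f y} (residue-≡ (f x) m)
      (subst (λ n → + n ≡ f y [mod m ]) (sym eq)
        (≡mod-sym {a = f y} (residue-≡ (f y) m))))

  perm : map r xs ↭ downFrom m
  perm = unique-⊆⇒↭ (AllPairs.map⁺ (AllPairs.map r-distinct u))
    (λ i∈ → let x , _ , eq = ∈-map⁻ r i∈ in
      subst (_∈ downFrom m) (sym eq) (∈-downFrom⁺ (n%ℕd<d (f x) m)))
    (ℕ.≤-reflexive (trans (length-downFrom m)
      (sym (trans (length-map r xs) len))))

-- Gauss's sum, arranged to avoid division by 2 and truncated subtraction.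
sum-downFrom : ∀ n → 2 ℕ.* sum (downFrom n) ℕ.+ n ≡ n ℕ.* n
sum-downFrom zero    = refl
sum-downFrom (suc n) = begin
  2 ℕ.* (n ℕ.+ sum (downFrom n)) ℕ.+ suc n
    ≡⟨ regroup n (sum (downFrom n)) ⟩
  (2 ℕ.* sum (downFrom n) ℕ.+ n) ℕ.+ (2 ℕ.* n ℕ.+ 1)
    ≡⟨ cong (ℕ._+ (2 ℕ.* n ℕ.+ 1)) (sum-downFrom n) ⟩
  n ℕ.* n ℕ.+ (2 ℕ.* n ℕ.+ 1)
    ≡⟨ square n ⟩
  suc n ℕ.* suc n ∎
  where
  open ≡-Reasoning
  regroup : ∀ n s → 2 ℕ.* (n ℕ.+ s) ℕ.+ (1 ℕ.+ n) ≡
                    (2 ℕ.* s ℕ.+ n) ℕ.+ (2 ℕ.* n ℕ.+ 1)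
  regroup = ℕ-Ring.solve-∀
  square : ∀ n → n ℕ.* n ℕ.+ (2 ℕ.* n ℕ.+ 1) ≡ (1 ℕ.+ n) ℕ.* (1 ℕ.+ n)
  square = ℕ-Ring.solve-∀

-- If the sum were `t * n`, Gauss's formula would give `(2 t + 1) n = n * n`, making `n` odd.
even∤sum-downFrom : ∀ {n} .{{_ : NonZero n}} → 2 ∣ n → ¬ n ∣ sum (downFrom n)
even∤sum-downFrom {n} 2∣n (ℕ.divides t eq) =
  contradiction (ℕ.∣1⇒≡1 (ℕ.∣m+n∣m⇒∣n (subst (2 ∣_) (sym odd) 2∣n)
    (ℕ.m∣m*n t))) λ ()
  where
  open ≡-Reasoning
  expand : ∀ t n → (2 ℕ.* t ℕ.+ 1) ℕ.* n ≡ 2 ℕ.* (t ℕ.* n) ℕ.+ n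
  expand = ℕ-Ring.solve-∀
  odd : 2 ℕ.* t ℕ.+ 1 ≡ n
  odd = ℕ.*-cancelʳ-≡ _ _ n (begin
    (2 ℕ.* t ℕ.+ 1) ℕ.* n        ≡⟨ expand t n ⟩
    2 ℕ.* (t ℕ.* n) ℕ.+ n        ≡⟨ cong (λ s → 2 ℕ.* s ℕ.+ n) eq ⟨
    2 ℕ.* sum (downFrom n) ℕ.+ n ≡⟨ sum-downFrom n ⟩
    n ℕ.* n                      ∎)

-- Impossibility for even parameters

length-cartesianProductWith :
  ∀ (g : A → B → C) xs ys →
  length (cartesianProductWith g xs ys) ≡ length xs ℕ.* length ys
length-cartesianProductWith g []       ys = refl
length-cartesianProductWith g (x ∷ xs) ys =
  trans (length-++ (map (g x) ys))
    (cong₂ ℕ._+_ (length-map (g x) ys) (length-cartesianProductWith g xs ys))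

length-allTuples : ∀ d q → length (allTuples d q) ≡ q ^ d
length-allTuples zero    q = refl
length-allTuples (suc d) q =
  trans (length-cartesianProductWith _∷_ (allFin q) (allTuples d q))
    (cong₂ ℕ._*_ (length-tabulate {n = q} id) (length-allTuples d q))

H-not-antimagic : ∀ d q .{{_ : NonZero d}} .{{_ : NonZero q}} → 2 ∣ d → 2 ∣ q →
                  ¬ DistanceAntimagic (H d q) (ℤmod (q ^ d))
H-not-antimagic d@(suc d-1) q (ℕ.divides e d≡e*2) 2∣q (f , (f-inj , _) , w-inj) =
  -- As `d` is a successor, `q ^ d` unfolds to a multiple of `q` and is therefore even.
  even∤sum-downFrom (ℕ.∣m⇒∣m*n (q ^ d-1) 2∣q)
    (ℤ.∣⇒∣ᵤ (subst (+ N ℤ.∣_) cancel (ℤ.∣m∣n⇒∣m-n N∣kT kT≡T)))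
  where
  N : ℕ
  N = q ^ d
  instance
    N≢0 : NonZero N
    N≢0 = ℕ.m^n≢0 q d

  s : ℕ
  s = sum (downFrom N)
  F T k : ℤ
  F = ∑ (allTuples d q) f
  T = + s
  k = + d * (+ q - 1ℤ)

  F≡T : F ≡ T [mod N ]
  F≡T = ∑-residues f (allTuples-unique d q) (length-allTuples d q)
    λ x y x≢y eq → x≢y (f-inj eq)

  -- The sum of the weights is exactly `k * F`, and distinct weights form a complete residue system
  -- too.
  kF≡T : k * F ≡ T [mod N ]
  kF≡T = subst (_≡ T [mod N ]) (∑-∑N d q f)
    (∑-residues (∑N f) (allTuples-unique d q) (length-allTuples d q) w-inj)

  kT≡T : k * T ≡ T [mod N ]
  kT≡T = ≡mod-trans {a = k * T} {k * F} {T}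
    (subst (+ N ℤ.∣_) (solve 3 (λ k T F → k :* (T :- F) := k :* T :- k :* F)
       refl k T F) (ℤ.∣n⇒∣m*n k (≡mod-sym {a = F} {T} F≡T)))
    kF≡T

  2T : + 2 * T ≡ + N * (+ N - 1ℤ)
  2T = begin
    + 2 * T                 ≡⟨ ℤ.pos-* 2 s ⟨
    + (2 ℕ.* s)             ≡⟨ solve 2 (λ a n → a := a :+ n :- n) refl _ (+ N) ⟩
    + (2 ℕ.* s ℕ.+ N) - + N ≡⟨ cong (λ n → + n - + N) (sum-downFrom N) ⟩
    + (N ℕ.* N) - + N       ≡⟨ cong (λ t → t - + N) (ℤ.pos-* N N) ⟩
    + N * + N - + N         ≡⟨ solve 1 (λ n → n :* n :- n := n :* (n :- con 1ℤ))
                                 refl (+ N) ⟩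
    + N * (+ N - 1ℤ)        ∎
    where open ≡-Reasoning

  -- Evenness of `d` enters here: the factor 2 of `d = e * 2` pairs with `T` to give
  -- `2 T = N (N - 1)`, a multiple of `N`.
  N∣kT : + N ℤ.∣ k * T
  N∣kT = subst (+ N ℤ.∣_) (sym kT)
    (ℤ.∣m⇒∣m*n _ (ℤ.∣m⇒∣m*n (+ N - 1ℤ) ℤ.∣-refl))
    where
    open ≡-Reasoning
    kT : k * T ≡ + N * (+ N - 1ℤ) * (+ e * (+ q - 1ℤ))
    kT = begin
      + d * (+ q - 1ℤ) * T
        ≡⟨ cong (λ n → n * (+ q - 1ℤ) * T)
             (trans (cong +_ d≡e*2) (ℤ.pos-* e 2)) ⟩
      + e * + 2 * (+ q - 1ℤ) * T
        ≡⟨ solve 4 (λ e c p T → e :* c :* p :* T := c :* T :* (e :* p)) refl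
             (+ e) (+ 2) (+ q - 1ℤ) T ⟩
      + 2 * T * (+ e * (+ q - 1ℤ))
        ≡⟨ cong (λ t → t * (+ e * (+ q - 1ℤ))) 2T ⟩
      + N * (+ N - 1ℤ) * (+ e * (+ q - 1ℤ)) ∎

  cancel : k * T - (k * T - T) ≡ T
  cancel = solve 2 (λ a b → a :- (a :- b) := b) refl (k * T) T

mainTheorem3 : (∀ (d q : ℕ) → 1 ≤ d → 2 ≤ q → gcd d q ≡ 1 →
    DistanceAntimagic (H d q) (ℤmod (q ^ d)))
    × (∀ (q : ℕ) → 2 ≤ q → DistanceAntimagic (K q) (ℤmod q))
    × (∀ (d q : ℕ) → 1 ≤ d → 2 ≤ q → 2 ∣ d → 2 ∣ q →
    ¬ DistanceAntimagic (H d q) (ℤmod (q ^ d)))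
mainTheorem3 =
  -- Matching on `suc` supplies the `NonZero` instances.
  (λ { d q@(suc _) _ _ gcd≡1 → H-antimagic d q (gcd≡1⇒coprime gcd≡1) }) ,
  (λ { q@(suc _) _ → K-antimagic q }) ,
  (λ { d@(suc _) q@(suc _) _ _ → H-not-antimagic d q })
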